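{- Given an interpretation of types, let $\Gamma\vdash r:\rho$ be a typed term with $\Gamma=(\rho_0,\dots,\rho_{n-1})$, and let $r:C\vdash i$ be a derivable state judgement, $C=(i_0,\dots,i_{n-1})$. Let $\vec A\in\llbracket\Gamma\rrbracket$ and $\vec a\in\llbracket\Gamma\rrbracket_C$ satisfy $A_k\rhd a_k$ for all $k<n$. Then, for the value $\llbracket r\rrbracket^i_{\vec a:C}$ computed along any derivation of $r:C\vdash i$, $$\llbracket r\rrbracket_{\vec A}\rhd\llbracket r\rrbracket^i_{\vec a:C}.$$
   Context: Factor systems: over a nonempty directed preorder $I$, sets $M_i$ with relations $\rhd\subseteq M_{i'}\times M_i$ ($i\le i'$, reflexive for $i=i'$); $a_i\approx b_j$ iff some $a_{i'}$ ($i'\ge i,j$) has $a_{i'}\rhd a_i$, $a_{i'}\rhd b_j$; prefactor: $a_{i'}\approx a_i\iff a_{i'}\rhd a_i$; a factor system is a prefactor system with $\approx$-preserving $\mathrm{emb}_{i,i'}:M_i\to M_{i'}$, $\mathrm{proj}_{i',i}:M_{i'}\to M_i$ ($i\le i'$) with $\mathrm{emb}_{i,i}(a)\approx a\approx\mathrm{proj}_{i,i}(a)$, composition laws up to $\approx$, $\mathrm{proj}_{i',i}\circ\mathrm{emb}_{i,i'}(a)\approx a$, and coherence $a_{i'}\rhd a_i\Rightarrow\mathrm{emb}_{i',i''}(a_{i'})\rhd a_i$, $a_{i''}\rhd a_i\Rightarrow\mathrm{proj}_{i'',i'}(a_{i''})\rhd a_i$. Direct: $a_{i'}\rhd a_i\iff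 a_{i'}\approx\mathrm{emb}_{i,i'}(a_i)$. Function space $[M_I\to N_J]$: index $I\times J$ (product order, written $i\to j$), $\approx$-preserving maps $M_i\to N_j$, $f'\rhd f$ iff ($a_{i'}\rhd a_i\Rightarrow f'(a_{i'})\rhd f(a_i)$), $\mathrm{emb}(f)=\mathrm{emb}_{j,j'}\circ f\circ\mathrm{proj}_{i',i}$, $\mathrm{proj}(f')=\mathrm{proj}_{j',j}\circ f'\circ\mathrm{emb}_{i,i'}$. A filter assignment gives for each index set $I$ a set $\mathcal F(I)$ of cofinal subsets, closed under supersets and finite intersections, containing all up-sets; Condition (D) is assumed: $H\in\mathcal F(I\times J)$, $I'\in\mathcal F(I)$ imply $\{j\mid\exists i\in I',\ i\to j\in H\}\in\mathcal F(J)$. A limit of a factor system: a set $M$ with a relation $a\rhd a_i$ ($a\in M$) such that $\{i\mid\exists a_i,\ a\rhd a_i\}\in\mathcal F(I)$, $a\rhd a_{i'},a\rhd a_i,i\le i'\Rightarrow a_{i'}\rhd a_i$, and which is maximal, extensional and complete. Types: $\rho::=\iota\mid\rho\to\rho$, base types $\iota$ including $\mathrm{prop}$. Positive types $\rho^+::=\iota\mid\rho^-\to\rho^+$; negative types $\rho^-::=\mathrm{prop}\mid\rho^+\to\rho^-$. Each type $\rho$ has an index set $I_\rho$, with $I_{\rho\to\sigma}=I_\rho\times I_\sigma$, $I_{\mathrm{prop}}=\{\mathrm{prop}\}$. An interpretation of types assigns to each type $\rho$ a factor system $(\llbracket\rho\rrbracket_i)_{i\in I_\rho}$ and a limit $\llbracket\rho\rrbracket$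 such that: base type factor systems are direct; $\llbracket\mathrm{prop}\rrbracket_{\mathrm{prop}}=\llbracket\mathrm{prop}\rrbracket=\{true,false\}$ with $\rhd$ equality; $\rho\to\sigma$ gets the function space factor system of those for $\rho,\sigma$ and limit $[\llbracket\rho\rrbracket\to_{\mathcal F}\llbracket\sigma\rrbracket]$, the functions $f:\llbracket\rho\rrbracket\to\llbracket\sigma\rrbracket$ with $\{i\to j\mid\exists f_{i\to j},\ f\rhd f_{i\to j}\}\in\mathcal F(I_\rho\times I_\sigma)$, where $f\rhd f_{i\to j}$ iff $a\rhd a_i$ implies $f(a)\rhd f_{i\to j}(a_i)$. Terms: $r::=x_k\mid rr\mid\lambda x_k^\rho r$. Typing judgements $\Gamma\vdash r:\rho$, $\Gamma=(\rho_0,\dots,\rho_{n-1})$: $\Gamma\vdash x_k:\rho_k$ for $k<n$; from $\Gamma\vdash r:\rho\to\sigma$ and $\Gamma\vdash s:\rho$ infer $\Gamma\vdash rs:\sigma$; from $\Gamma.\rho\vdash r:\sigma$ infer $\Gamma\vdash\lambda x_n^\rho r:\rho\to\sigma$ ($\Gamma.\rho$ extends $\Gamma$ by $\rho$ as variable $x_n$). State judgements $r:C\vdash i$ (for $\Gamma\vdash r:\rho$, $C=(i_0,\dots,i_{n-1})\in I_{\rho_0}\times\dots\times I_{\rho_{n-1}}$, $i\in I_\rho$): (Var+) if $\rho_k$ is positive and $j\in I_{\rho_k}$, $j\ge i_k$, then $x_k:C\vdash j$; (Var$-$) if $\rho_k$ is negative and $j\le i_k$, then $x_k:C\vdash j$;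 (App) from $r:C\vdash i\to j$ and $s:C\vdash i$ infer $rs:C\vdash j$; (Abs) from $r:C.i\vdash j$ infer $\lambda x_n^\rho r:C\vdash i\to j$. Limit values: for $\vec A\in\llbracket\Gamma\rrbracket:=\llbracket\rho_0\rrbracket\times\dots\times\llbracket\rho_{n-1}\rrbracket$: $\llbracket x_k\rrbracket_{\vec A}=A_k$, $\llbracket rs\rrbracket_{\vec A}=\llbracket r\rrbracket_{\vec A}(\llbracket s\rrbracket_{\vec A})$, $\llbracket\lambda x_n^\rho r\rrbracket_{\vec A}(B)=\llbracket r\rrbracket_{\vec A.B}$. State values for $\vec a\in\llbracket\Gamma\rrbracket_C:=\llbracket\rho_0\rrbracket_{i_0}\times\dots\times\llbracket\rho_{n-1}\rrbracket_{i_{n-1}}$, by recursion on the derivation: $\llbracket x_k\rrbracket^j_{\vec a:C}=\mathrm{emb}_{i_k,j}(a_k)$ if $\rho_k$ positive (Var+), $=\mathrm{proj}_{i_k,j}(a_k)$ if $\rho_k$ negative (Var$-$); $\llbracket rs\rrbracket^j_{\vec a:C}=\llbracket r\rrbracket^{i\to j}_{\vec a:C}(\llbracket s\rrbracket^i_{\vec a:C})$; $\llbracket\lambda x_n^\rho r\rrbracket^{i\to j}_{\vec a:C}$ is the map $b\mapsto\llbracket r\rrbracket^j_{\vec a.b:C.i}$ on $\llbracket\rho\rrbracket_i$. -}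

module Defs where

open import Data.Nat using (ℕ; suc)
open import Data.Unit using (⊤; tt)
open import Data.Bool using (Bool)
open import Data.Product using (Σ; _×_; _,_; proj₁; proj₂; Σ-syntax)
open import Relation.Binary.PropositionalEquality using (_≡_; refl)

record DirPreorder : Set₁ where
  field
    Carrier   : Set
    _≤_       : Carrier → Carrier → Set
    ≤-refl    : ∀ {i} → i ≤ i
    ≤-trans   : ∀ {i j k} → i ≤ j → j ≤ k → i ≤ k
    inhabited : Carrier
    directed  : ∀ i j → Σ[ k ∈ Carrier ] (i ≤ k × j ≤ k)

open DirPreorder public using (Carrier)

module _ (I J : DirPreorder) where
  private
    module I = DirPreorder I
    module J = DirPreorder J

    PC : Set
    PC = I.Carrier × J.Carrier

    _≤P_ : PC → PC → Set
    p ≤P q = (proj₁ p I.≤ proj₁ q) × (proj₂ p J.≤ proj₂ q)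

    trP : ∀ {p q r} → p ≤P q → q ≤P r → p ≤P r
    trP (a , b) (c , d) = I.≤-trans a c , J.≤-trans b d

    dirP : ∀ p q → Σ[ r ∈ PC ] (p ≤P r × q ≤P r)
    dirP (i , j) (i' , j') with I.directed i i' | J.directed j j'
    ... | (k , a , b) | (l , c , d) = (k , l) , (a , c) , (b , d)

  _×ₚ_ : DirPreorder
  _×ₚ_ = record
    { Carrier = PC ; _≤_ = _≤P_ ; ≤-refl = I.≤-refl , J.≤-refl
    ; ≤-trans = trP ; inhabited = I.inhabited , J.inhabited ; directed = dirP }

unitPre : DirPreorder
unitPre = record
  { Carrier = ⊤ ; _≤_ = λ _ _ → ⊤ ; ≤-refl = tt ; ≤-trans = λ _ _ → tt
  ; inhabited = tt ; directed = λ _ _ → tt , tt , tt }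

record FilterAssignment : Set₁ where
  field
    F : (I : DirPreorder) → (Carrier I → Set) → Set
    F-cofinal : ∀ I X → F I X → ∀ i → Σ[ j ∈ Carrier I ] (DirPreorder._≤_ I i j × X j)
    F-superset : ∀ I X Y → F I X → (∀ i → X i → Y i) → F I Y
    -- closed under finite intersections (binary; the empty intersection,
    -- i.e. the whole index set, is an up-set)
    F-∩ : ∀ I X Y → F I X → F I Y → F I (λ i → X i × Y i)
    -- contains all (nonempty, hence cofinal) up-sets
    F-upset : ∀ I X → (∀ i j → DirPreorder._≤_ I i j → X i → X j)
              → Σ[ i ∈ Carrier I ] X i → F I X
    F-D : ∀ I J (H : Carrier (I ×ₚ J) → Set) (I' : Carrier I → Set)
          → F (I ×ₚ J) H → F I I'
          → F J (λ j → Σ[ i ∈ Carrier I ] (I' i × H (i , j)))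

-- Raw data of a factor system over I.
-- M i is the carrier type at index i, El i picks out the actual elements
-- of the set M_i (needed for function spaces, whose elements are the
-- ≈-preserving maps); R i' i a' a is a_{i'} ▷ a_i.
-- emb i i' / proj i' i are only constrained for i ≤ i'.

record FSData (I : DirPreorder) : Set₁ where
  field
    M    : Carrier I → Set
    El   : ∀ i → M i → Set
    R    : ∀ i' i → M i' → M i → Set
    emb  : ∀ i i' → M i → M i'
    proj : ∀ i' i → M i' → M i

Approx : ∀ {I} (D : FSData I) → ∀ i j → FSData.M D i → FSData.M D j → Set
Approx {I} D i j a b =
  Σ[ k ∈ Carrier I ] (DirPreorder._≤_ I i k × DirPreorder._≤_ I j k ×
    Σ[ c ∈ FSData.M D k ] (FSData.El D k c × FSData.R D k i c a × FSData.R D k j c b))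

record IsFactorSystem {I : DirPreorder} (D : FSData I) : Set where
  open DirPreorder I
  open FSData D
  field
    R-El  : ∀ {i i'} {a' a} → R i' i a' a → El i' a' × El i a
    R-≤   : ∀ {i i'} {a' a} → R i' i a' a → i ≤ i'
    R-refl : ∀ {i} a → El i a → R i i a a
    prefactor : ∀ {i i'} a' a → i ≤ i' → El i' a' → El i a →
                (Approx D i' i a' a → R i' i a' a) × (R i' i a' a → Approx D i' i a' a)
    emb-El  : ∀ {i i'} a → i ≤ i' → El i a → El i' (emb i i' a)
    proj-El : ∀ {i i'} a → i ≤ i' → El i' a → El i (proj i' i a)
    emb-≈  : ∀ {i i'} a b → i ≤ i' → El i a → El i b →
             Approx D i i a b → Approx D i' i' (emb i i' a) (emb i i' b)
    proj-≈ : ∀ {i i'} a b → i ≤ i' → El i' a → El i' b →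
             Approx D i' i' a b → Approx D i i (proj i' i a) (proj i' i b)
    emb-id  : ∀ {i} a → El i a → Approx D i i (emb i i a) a
    proj-id : ∀ {i} a → El i a → Approx D i i a (proj i i a)
    emb-comp  : ∀ {i i' i''} a → i ≤ i' → i' ≤ i'' → El i a →
                Approx D i'' i'' (emb i' i'' (emb i i' a)) (emb i i'' a)
    proj-comp : ∀ {i i' i''} a → i ≤ i' → i' ≤ i'' → El i'' a →
                Approx D i i (proj i' i (proj i'' i' a)) (proj i'' i a)
    proj-emb  : ∀ {i i'} a → i ≤ i' → El i a → Approx D i i (proj i' i (emb i i' a)) a
    emb-coh  : ∀ {i i' i''} a' a → i ≤ i' → i' ≤ i'' → R i' i a' a → R i'' i (emb i' i'' a') a
    proj-coh : ∀ {i i' i''} a'' a → i ≤ i' → i' ≤ i'' → R i'' i a'' a → R i' i (proj i'' i' a'') a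

IsDirect : ∀ {I} → FSData I → Set
IsDirect {I} D = ∀ {i i'} a' a → DirPreorder._≤_ I i i' → El i' a' → El i a →
  (R i' i a' a → Approx D i' i' a' (emb i i' a)) × (Approx D i' i' a' (emb i i' a) → R i' i a' a)
  where open FSData D

module _ {I J : DirPreorder} (D : FSData I) (E : FSData J) where
  private
    module D = FSData D
    module E = FSData E
    module I = DirPreorder I
    module J = DirPreorder J

  funM : Carrier (I ×ₚ J) → Set
  funM (i , j) = D.M i → E.M j

  funEl : ∀ ij → funM ij → Set
  funEl (i , j) f = (∀ a → D.El i a → E.El j (f a)) ×
                    (∀ a b → D.El i a → D.El i b → Approx D i i a b → Approx E j j (f a) (f b))

  funR : ∀ i'j' ij → funM i'j' → funM ij → Set
  funR (i' , j') (i , j) f' f =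
    funEl (i' , j') f' × funEl (i , j) f × i I.≤ i' × j J.≤ j' ×
    (∀ a' a → D.R i' i a' a → E.R j' j (f' a') (f a))

  funFS : FSData (I ×ₚ J)
  funFS = record
    { M = funM ; El = funEl ; R = funR
    ; emb = λ { (i , j) (i' , j') f a → E.emb j j' (f (D.proj i' i a)) }
    ; proj = λ { (i' , j') (i , j) f a → E.proj j' j (f (D.emb i i' a)) } }

propFS : FSData unitPre
propFS = record
  { M = λ _ → Bool ; El = λ _ _ → ⊤ ; R = λ _ _ a b → a ≡ b
  ; emb = λ _ _ a → a ; proj = λ _ _ a → a }

-- factor system data for an ordinary base type (its M_i are plain sets)
record BaseFS (I : DirPreorder) : Set₁ where
  field
    M    : Carrier I → Set
    R    : ∀ i' i → M i' → M i → Set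
    emb  : ∀ i i' → M i → M i'
    proj : ∀ i' i → M i' → M i

baseFS : ∀ {I} → BaseFS I → FSData I
baseFS B = record { M = M ; El = λ _ _ → ⊤ ; R = R ; emb = emb ; proj = proj }
  where open BaseFS B

-- Limits.  L is a carrier, In picks out the elements of the limit set,
-- Eq is equality of the limit set, LR a i x is a ▷ x for x ∈ M_i.

record LimData {I : DirPreorder} (D : FSData I) : Set₁ where
  field
    L  : Set
    In : L → Set
    Eq : L → L → Set
    LR : L → ∀ i → FSData.M D i → Set

module _ (𝓕 : FilterAssignment) {I : DirPreorder} (D : FSData I) (Lm : LimData D) where
  open FilterAssignment 𝓕
  open DirPreorder I
  open FSData D
  open LimData Lm

  -- a family of approximations (subset of ⋃ M_i)
  Thread : (∀ i → M i → Set) → Set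
  Thread X = (∀ i x → X i x → El i x) ×
             F I (λ i → Σ[ x ∈ M i ] X i x) ×
             (∀ i i' x' x → i ≤ i' → X i' x' → X i x → R i' i x' x)

  MaxThread : (∀ i → M i → Set) → Set₁
  MaxThread X = Thread X ×
    (∀ Y → Thread Y → (∀ i x → X i x → Y i x) → ∀ i x → Y i x → X i x)

  record IsLimit : Set₁ where
    field
      LR-El  : ∀ a i x → LR a i x → El i x
      filter : ∀ a → In a → F I (λ i → Σ[ x ∈ M i ] LR a i x)
      coh    : ∀ a → In a → ∀ i i' x' x → i ≤ i' → LR a i' x' → LR a i x → R i' i x' x
      maximal : ∀ a → In a → ∀ Y → Thread Y → (∀ i x → LR a i x → Y i x) →
                ∀ i x → Y i x → LR a i x
      extensional : ∀ a b → In a → In b →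
                    (∀ i x → (LR a i x → LR b i x) × (LR b i x → LR a i x)) → Eq a b
      complete : ∀ X → MaxThread X →
                 Σ[ a ∈ L ] (In a × (∀ i x → (LR a i x → X i x) × (X i x → LR a i x)))

module _ (𝓕 : FilterAssignment) {I J : DirPreorder} {D : FSData I} {E : FSData J}
         (LD : LimData D) (LE : LimData E) where
  private
    module LD = LimData LD
    module LE = LimData LE

  funLR : (LD.L → LE.L) → ∀ ij → funM D E ij → Set
  funLR f (i , j) g = funEl D E (i , j) g ×
    (∀ a x → LD.In a → LD.LR a i x → LE.LR (f a) j (g x))

  funLim : LimData (funFS D E)
  funLim = record
    { L = LD.L → LE.L
    ; In = λ f → (∀ a → LD.In a → LE.In (f a)) ×
                 (∀ a b → LD.In a → LD.In b → LD.Eq a b → LE.Eq (f a) (f b)) ×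
                 FilterAssignment.F 𝓕 (I ×ₚ J) (λ ij → Σ[ g ∈ funM D E ij ] funLR f ij g)
    ; Eq = λ f g → ∀ a → LD.In a → LE.Eq (f a) (g a)
    ; LR = funLR }

propLim : LimData propFS
propLim = record { L = Bool ; In = λ _ → ⊤ ; Eq = _≡_ ; LR = λ a _ x → a ≡ x }

data Ty (B : Set) : Set where
  prop : Ty B
  base : B → Ty B
  _⇒_  : Ty B → Ty B → Ty B

infixr 30 _⇒_

mutual
  data Pos {B : Set} : Ty B → Set where
    pos-prop : Pos prop
    pos-base : ∀ b → Pos (base b)
    pos-fun  : ∀ {ρ σ} → Neg ρ → Pos σ → Pos (ρ ⇒ σ)

  data Neg {B : Set} : Ty B → Set where
    neg-prop : Neg prop
    neg-fun  : ∀ {ρ σ} → Pos ρ → Neg σ → Neg (ρ ⇒ σ)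

-- raw terms; variables x_k by index k, λ x_k^ρ r
data Tm (B : Set) : Set where
  var : ℕ → Tm B
  app : Tm B → Tm B → Tm B
  lam : ℕ → Ty B → Tm B → Tm B

data Ctx (B : Set) : Set where
  ε   : Ctx B
  _▸_ : Ctx B → Ty B → Ctx B

len : ∀ {B} → Ctx B → ℕ
len ε = 0
len (Γ ▸ _) = suc (len Γ)

data _∋_∶_ {B : Set} : Ctx B → ℕ → Ty B → Set where
  here  : ∀ {Γ ρ} → (Γ ▸ ρ) ∋ len Γ ∶ ρ
  there : ∀ {Γ k ρ σ} → Γ ∋ k ∶ ρ → (Γ ▸ σ) ∋ k ∶ ρ

data _⊢_∶_ {B : Set} (Γ : Ctx B) : Tm B → Ty B → Set where
  ⊢var : ∀ {k ρ} → Γ ∋ k ∶ ρ → Γ ⊢ var k ∶ ρ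
  ⊢app : ∀ {r s ρ σ} → Γ ⊢ r ∶ (ρ ⇒ σ) → Γ ⊢ s ∶ ρ → Γ ⊢ app r s ∶ σ
  ⊢lam : ∀ {r ρ σ} → (Γ ▸ ρ) ⊢ r ∶ σ → Γ ⊢ lam (len Γ) ρ r ∶ (ρ ⇒ σ)

record Interp (B : Set) : Set₁ where
  field
    Ib  : B → DirPreorder
    Db  : (b : B) → BaseFS (Ib b)
    Lb  : B → Set
    LRb : (b : B) → Lb b → ∀ i → BaseFS.M (Db b) i → Set

module Semantics (𝓕 : FilterAssignment) {B : Set} (𝓘 : Interp B) where
  open Interp 𝓘

  Idx : Ty B → DirPreorder
  Idx prop = unitPre
  Idx (base b) = Ib b
  Idx (ρ ⇒ σ) = Idx ρ ×ₚ Idx σ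

  Dat : (ρ : Ty B) → FSData (Idx ρ)
  Dat prop = propFS
  Dat (base b) = baseFS (Db b)
  Dat (ρ ⇒ σ) = funFS (Dat ρ) (Dat σ)

  Lim : (ρ : Ty B) → LimData (Dat ρ)
  Lim prop = propLim
  Lim (base b) = record { L = Lb b ; In = λ _ → ⊤ ; Eq = _≡_ ; LR = LRb b }
  Lim (ρ ⇒ σ) = funLim 𝓕 (Lim ρ) (Lim σ)

  Ix : Ty B → Set
  Ix ρ = Carrier (Idx ρ)

  Mv : (ρ : Ty B) → Ix ρ → Set
  Mv ρ = FSData.M (Dat ρ)

  Lv : Ty B → Set
  Lv ρ = LimData.L (Lim ρ)

  IEnv : Ctx B → Set
  IEnv ε = ⊤
  IEnv (Γ ▸ ρ) = IEnv Γ × Ix ρ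

  LEnv : Ctx B → Set
  LEnv ε = ⊤
  LEnv (Γ ▸ ρ) = LEnv Γ × Lv ρ

  SEnv : (Γ : Ctx B) → IEnv Γ → Set
  SEnv ε _ = ⊤
  SEnv (Γ ▸ ρ) (C , i) = SEnv Γ C × Mv ρ i

  ilookup : ∀ {Γ k ρ} → Γ ∋ k ∶ ρ → IEnv Γ → Ix ρ
  ilookup here (_ , i) = i
  ilookup (there x) (C , _) = ilookup x C

  llookup : ∀ {Γ k ρ} → Γ ∋ k ∶ ρ → LEnv Γ → Lv ρ
  llookup here (_ , A) = A
  llookup (there x) (A , _) = llookup x A

  slookup : ∀ {Γ k ρ} (x : Γ ∋ k ∶ ρ) {C : IEnv Γ} → SEnv Γ C → Mv ρ (ilookup x C)
  slookup here {_ , _} (_ , a) = a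
  slookup (there x) {_ , _} (a , _) = slookup x a

  data _⊩_∶_ : ∀ {Γ r ρ} → Γ ⊢ r ∶ ρ → IEnv Γ → Ix ρ → Set where
    var+ : ∀ {Γ k ρ C} (x : Γ ∋ k ∶ ρ) → Pos ρ → (j : Ix ρ) →
           DirPreorder._≤_ (Idx ρ) (ilookup x C) j → ⊢var x ⊩ C ∶ j
    var- : ∀ {Γ k ρ C} (x : Γ ∋ k ∶ ρ) → Neg ρ → (j : Ix ρ) →
           DirPreorder._≤_ (Idx ρ) j (ilookup x C) → ⊢var x ⊩ C ∶ j
    app  : ∀ {Γ r s ρ σ C} {t : Γ ⊢ r ∶ (ρ ⇒ σ)} {u : Γ ⊢ s ∶ ρ} {i : Ix ρ} {j : Ix σ} →
           t ⊩ C ∶ (i , j) → u ⊩ C ∶ i → ⊢app t u ⊩ C ∶ j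
    lam  : ∀ {Γ r ρ σ C} {t : (Γ ▸ ρ) ⊢ r ∶ σ} {i : Ix ρ} {j : Ix σ} →
           t ⊩ (C , i) ∶ j → ⊢lam t ⊩ C ∶ (i , j)

  lval : ∀ {Γ r ρ} → Γ ⊢ r ∶ ρ → LEnv Γ → Lv ρ
  lval (⊢var x) A = llookup x A
  lval (⊢app t u) A = lval t A (lval u A)
  lval (⊢lam t) A = λ b → lval t (A , b)

  sval : ∀ {Γ r ρ} {t : Γ ⊢ r ∶ ρ} {C : IEnv Γ} {i : Ix ρ} → t ⊩ C ∶ i → SEnv Γ C → Mv ρ i
  sval {C = C} (var+ {ρ = ρ} x _ j _) a = FSData.emb (Dat ρ) (ilookup x C) j (slookup x a)
  sval {C = C} (var- {ρ = ρ} x _ j _) a = FSData.proj (Dat ρ) (ilookup x C) j (slookup x a)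
  sval (app d e) a = sval d a (sval e a)
  sval (lam d) a = λ b → sval d (a , b)

record IsInterp (𝓕 : FilterAssignment) {B : Set} (𝓘 : Interp B) : Set₁ where
  open Semantics 𝓕 𝓘
  field
    factor : ∀ ρ → IsFactorSystem (Dat ρ)
    direct : ∀ b → IsDirect (Dat (base b))
    limit  : ∀ ρ → IsLimit 𝓕 (Dat ρ) (Lim ρ)

{-# OPTIONS --safe #-}

-- The induction on derivations needs, in the application case r s, that the
-- limit value of s is an element of the limit.  This fails for general types
-- (the identity on a base type need not have 𝓕-many approximations), but it
-- holds for positive and negative types: approximations of positive elements
-- are preserved by emb, those of negative elements by proj, so a positive
-- element needs a single approximation, while a negative one needs one at
-- every index.  The latter are state values, since a derivable state judgement
-- stays derivable for prescribed non-negative indices after raising the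
-- negative ones.  Variables whose type is neither positive nor negative
-- have no state judgement, so nothing has to be known about their values.
module Submission where

open import Data.Product using (Σ-syntax; _×_; _,_; proj₁; proj₂)
open import Data.Sum using (_⊎_; inj₁; inj₂)
open import Data.Unit using (⊤; tt)
open import Relation.Binary.PropositionalEquality using (_≡_; refl; sym; cong₂; subst)
open import Relation.Nullary using (Dec; yes; no; contradiction)

open import Defs

-- Calculus of `R` in a factor system

module FactorSystem {I : DirPreorder} {D : FSData I} (fs : IsFactorSystem D) where
  open DirPreorder I
  open FSData D
  open IsFactorSystem fs

  -- The element `z` witnesses that `y'` and `y` are close, and the prefactor condition turns
  -- closeness back into `R`.
  common⇒R : ∀ {k i' i z y' y} → i ≤ i' → R k i' z y' → R k i z y → R i' i y' y
  common⇒R i≤i' zy' zy =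
    proj₁ (prefactor _ _ i≤i' (proj₂ (R-El zy')) (proj₂ (R-El zy)))
      (_ , R-≤ zy' , R-≤ zy , _ , proj₁ (R-El zy') , zy' , zy)

  R⇒≈ : ∀ {i' i a' a} → R i' i a' a → Approx D i' i a' a
  R⇒≈ r = proj₂ (prefactor _ _ (R-≤ r) (proj₁ (R-El r)) (proj₂ (R-El r))) r

  ≈⇒R : ∀ {i a b} → Approx D i i a b → R i i a b
  ≈⇒R (_ , _ , _ , _ , _ , ca , cb) = common⇒R ≤-refl ca cb

  R-reflˡ : ∀ {i' i a' a} → R i' i a' a → R i' i' a' a'
  R-reflˡ r = R-refl _ (proj₁ (R-El r))

  R-sym : ∀ {i a b} → R i i a b → R i i b a
  R-sym r = common⇒R ≤-refl r (R-reflˡ r)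

  R-trans : ∀ {i a b c} → R i i a b → R i i b c → R i i a c
  R-trans ab bc = common⇒R ≤-refl (R-sym ab) bc

  emb-R : ∀ {i i' a b} → i ≤ i' → R i i a b → R i' i' (emb i i' a) (emb i i' b)
  emb-R i≤i' r = ≈⇒R (emb-≈ _ _ i≤i' (proj₁ (R-El r)) (proj₂ (R-El r)) (R⇒≈ r))

  proj-R : ∀ {i i' a b} → i ≤ i' → R i' i' a b → R i i (proj i' i a) (proj i' i b)
  proj-R i≤i' r = ≈⇒R (proj-≈ _ _ i≤i' (proj₁ (R-El r)) (proj₂ (R-El r)) (R⇒≈ r))

-- Approximations of limit elements

module Limit (𝓕 : FilterAssignment) {I : DirPreorder} {D : FSData I} {Lm : LimData D}
             (fs : IsFactorSystem D) (lim : IsLimit 𝓕 D Lm) where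
  open FilterAssignment 𝓕
  open DirPreorder I
  open FSData D
  open LimData Lm
  open IsFactorSystem fs
  open IsLimit lim
  open FactorSystem fs

  Approximable : L → Set
  Approximable a = F I (λ i → Σ[ x ∈ M i ] LR a i x)

  above : ∀ {a} → In a → ∀ i → Σ[ k ∈ Carrier I ] (i ≤ k × Σ[ z ∈ M k ] LR a k z)
  above {a} ina = F-cofinal I _ (filter a ina)

  -- The elements below all approximations of a form a thread, so this is maximality.
  LR-intro : ∀ {a} → In a → ∀ {i y} → El i y →
             (∀ k z → i ≤ k → LR a k z → R k i z y) → LR a i y
  LR-intro {a} ina {i} {y} ely below = maximal a ina Below thread LR⊆Below i y (ely , below)
    where
    Below : ∀ i → M i → Set
    Below i y = El i y × (∀ k z → i ≤ k → LR a k z → R k i z y)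

    LR⊆Below : ∀ i x → LR a i x → Below i x
    LR⊆Below i x ax = LR-El a i x ax , λ k z i≤k az → coh a ina i k z x i≤k az ax

    thread : Thread 𝓕 D Lm Below
    thread =
      (λ _ _ → proj₁) ,
      F-superset I _ _ (filter a ina) (λ { i (x , ax) → x , LR⊆Below i x ax }) ,
      λ i i' x' x i≤i' (_ , below') (_ , below) →
        let (k , i'≤k , z , az) = above ina i'
        in common⇒R i≤i' (below' k z i'≤k az) (below k z (≤-trans i≤i' i'≤k) az)

-- Positive and negative types

module Polarity {B : Set} where

  -- `rederive` needs `neg?` to choose which side of an application comes first.
  pos? : (ρ : Ty B) → Dec (Pos ρ)
  neg? : (ρ : Ty B) → Dec (Neg ρ)

  pos? prop = yes pos-prop
  pos? (base b) = yes (pos-base b)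
  pos? (ρ ⇒ σ) with neg? ρ | pos? σ
  ... | yes n | yes p = yes (pos-fun n p)
  ... | no ¬n | _     = no λ { (pos-fun n _) → ¬n n }
  ... | _     | no ¬p = no λ { (pos-fun _ p) → ¬p p }

  neg? prop = yes neg-prop
  neg? (base b) = no λ ()
  neg? (ρ ⇒ σ) with pos? ρ | neg? σ
  ... | yes p | yes n = yes (neg-fun p n)
  ... | no ¬p | _     = no λ { (neg-fun p _) → ¬p p }
  ... | _     | no ¬n = no λ { (neg-fun _ n) → ¬n n }

  Polarised : Ty B → Set
  Polarised ρ = Pos ρ ⊎ Neg ρ

  polarised-dom : ∀ {ρ σ} → Polarised (ρ ⇒ σ) → Polarised ρ
  polarised-dom (inj₁ (pos-fun n _)) = inj₂ n
  polarised-dom (inj₂ (neg-fun p _)) = inj₁ p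

  polarised-cod : ∀ {ρ σ} → Polarised (ρ ⇒ σ) → Polarised σ
  polarised-cod (inj₁ (pos-fun _ p)) = inj₁ p
  polarised-cod (inj₂ (neg-fun _ n)) = inj₂ n

-- State judgements at prescribed indices

module Derivations (𝓕 : FilterAssignment) {B : Set} (𝓘 : Interp B) where
  open Semantics 𝓕 𝓘
  open Polarity {B}

  module Ord (ρ : Ty B) = DirPreorder (Idx ρ)

  -- Such a type is built from `prop` alone, so its index set has a single element.
  pos-neg⇒≡ : ∀ {ρ} → Pos ρ → Neg ρ → (i j : Ix ρ) → i ≡ j
  pos-neg⇒≡ pos-prop neg-prop _ _ = refl
  pos-neg⇒≡ (pos-fun n p) (neg-fun p' n') (i , j) (i' , j') =
    cong₂ _,_ (pos-neg⇒≡ p' n i i') (pos-neg⇒≡ p n' j j')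

  RaiseNeg : (ρ : Ty B) → Ix ρ → Ix ρ → Set
  RaiseNeg ρ i i' = i ≡ i' ⊎ (Neg ρ × Ord._≤_ ρ i i')

  raiseNeg-trans : ∀ {ρ i j k} → RaiseNeg ρ i j → RaiseNeg ρ j k → RaiseNeg ρ i k
  raiseNeg-trans (inj₁ refl) s = s
  raiseNeg-trans (inj₂ r) (inj₁ refl) = inj₂ r
  raiseNeg-trans {ρ} (inj₂ (n , p)) (inj₂ (_ , q)) = inj₂ (n , Ord.≤-trans ρ p q)

  raiseNeg-pos : ∀ {ρ i i'} → Pos ρ → RaiseNeg ρ i i' → i ≡ i'
  raiseNeg-pos p (inj₁ e) = e
  raiseNeg-pos p (inj₂ (n , _)) = pos-neg⇒≡ p n _ _

  RaiseEnv : (Γ : Ctx B) → IEnv Γ → IEnv Γ → Set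
  RaiseEnv ε _ _ = ⊤
  RaiseEnv (Γ ▸ ρ) (C , i) (C' , i') = RaiseEnv Γ C C' × RaiseNeg ρ i i'

  raiseEnv-refl : ∀ Γ {C} → RaiseEnv Γ C C
  raiseEnv-refl ε = tt
  raiseEnv-refl (Γ ▸ ρ) = raiseEnv-refl Γ , inj₁ refl

  raiseEnv-trans : ∀ Γ {C C' C''} → RaiseEnv Γ C C' → RaiseEnv Γ C' C'' → RaiseEnv Γ C C''
  raiseEnv-trans ε _ _ = tt
  raiseEnv-trans (Γ ▸ ρ) (R , r) (S , s) = raiseEnv-trans Γ R S , raiseNeg-trans r s

  raiseEnv-lookup : ∀ {Γ k ρ C C'} (x : Γ ∋ k ∶ ρ) → RaiseEnv Γ C C' →
                    RaiseNeg ρ (ilookup x C) (ilookup x C')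
  raiseEnv-lookup here (_ , r) = r
  raiseEnv-lookup (there x) (R , _) = raiseEnv-lookup x R

  raise-var : ∀ {Γ k ρ} (x : Γ ∋ k ∶ ρ) → Neg ρ → (C : IEnv Γ) (i : Ix ρ) →
              Σ[ C' ∈ IEnv Γ ] (RaiseEnv Γ C C' × Ord._≤_ ρ i (ilookup x C'))
  raise-var {Γ ▸ ρ} here n (C , c) i =
    let (c' , c≤c' , i≤c') = Ord.directed ρ c i
    in (C , c') , (raiseEnv-refl Γ , inj₂ (n , c≤c')) , i≤c'
  raise-var (there x) n (C , c) i =
    let (C' , R , i≤) = raise-var x n C i
    in (C' , c) , (R , inj₁ refl) , i≤

  -- A negative variable only asks its entry to lie above the target index, so a larger entry serves
  -- as well; the entry of a positive variable does not move.
  ⊩-raise : ∀ {Γ r ρ} {t : Γ ⊢ r ∶ ρ} {C C' i} → RaiseEnv Γ C C' → t ⊩ C ∶ i → t ⊩ C' ∶ i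
  ⊩-raise R (var+ {ρ = ρ} x p j c≤j) =
    var+ x p j (subst (λ c → Ord._≤_ ρ c j) (raiseNeg-pos p (raiseEnv-lookup x R)) c≤j)
  ⊩-raise R (var- {ρ = ρ} x n j j≤c) with raiseEnv-lookup x R
  ... | inj₁ e = var- x n j (subst (Ord._≤_ ρ j) e j≤c)
  ... | inj₂ (_ , c≤c') = var- x n j (Ord.≤-trans ρ j≤c c≤c')
  ⊩-raise R (app d e) = app (⊩-raise R d) (⊩-raise R e)
  ⊩-raise R (lam d) = lam (⊩-raise (R , inj₁ refl) d)

  -- Arguments are raised as in RaiseNeg, the index of a base type result is arbitrary.
  Adjust : (ρ : Ty B) → Ix ρ → Ix ρ → Set
  Adjust prop _ _ = ⊤
  Adjust (base b) _ _ = ⊤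
  Adjust (ρ ⇒ σ) (i , j) (i' , j') = RaiseNeg ρ i i' × Adjust σ j j'

  adjust-refl : ∀ ρ {i} → Adjust ρ i i
  adjust-refl prop = tt
  adjust-refl (base b) = tt
  adjust-refl (ρ ⇒ σ) = inj₁ refl , adjust-refl σ

  -- A negative type ends in `prop` and takes positive arguments, whose indices `RaiseNeg` cannot
  -- move.
  adjust-neg : ∀ {ρ i i'} → Neg ρ → Adjust ρ i i' → i ≡ i'
  adjust-neg neg-prop _ = refl
  adjust-neg (neg-fun p n) (r , s) = cong₂ _,_ (raiseNeg-pos p r) (adjust-neg n s)

  adjust-above : ∀ {ρ} → Pos ρ → (c i : Ix ρ) → Σ[ i' ∈ Ix ρ ] (Ord._≤_ ρ c i' × Adjust ρ i i')
  adjust-above pos-prop _ _ = tt , tt , tt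
  adjust-above (pos-base b) c _ = c , Ord.≤-refl (base b) , tt
  adjust-above {ρ ⇒ σ} (pos-fun n p) (c , d) (i , j) =
    let (i' , c≤i' , i≤i') = Ord.directed ρ c i
        (j' , d≤j' , s)    = adjust-above p d j
    in (i' , j') , (c≤i' , d≤j') , inj₂ (n , i≤i') , s

  -- Only the shape of the given derivation survives. What a negative variable demands is met by
  -- raising its entry; what a positive variable produces is absorbed by `Adjust`.
  rederive : ∀ {Γ r ρ} {t : Γ ⊢ r ∶ ρ} {C₀ i₀} → t ⊩ C₀ ∶ i₀ → (C : IEnv Γ) (i : Ix ρ) →
             Σ[ C' ∈ IEnv Γ ] Σ[ i' ∈ Ix ρ ] (RaiseEnv Γ C C' × Adjust ρ i i' × t ⊩ C' ∶ i')
  rederive {Γ} (var+ x p _ _) C i =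
    let (i' , c≤i' , s) = adjust-above p (ilookup x C) i
    in C , i' , raiseEnv-refl Γ , s , var+ x p i' c≤i'
  rederive {ρ = ρ} (var- x n _ _) C i =
    let (C' , R , i≤c') = raise-var x n C i
    in C' , i , R , adjust-refl ρ , var- x n i i≤c'
  -- For negative ρ the function demands an index of its argument,
  -- otherwise the argument offers one to the function.
  rederive {Γ} (app {ρ = ρ} {u = u} d e) C j with neg? ρ
  ... | yes n =
    -- The requested argument index is a placeholder: `d` answers with some `i₁`, and for negative
    -- `ρ` the argument can be rederived at exactly `i₁`.
    let (C₁ , (i₁ , j₁) , R₁ , (_ , s) , d₁) = rederive d C (Ord.inhabited ρ , j)
        (C₂ , i₂ , R₂ , a , e₂)              = rederive e C₁ i₁
    in C₂ , j₁ , raiseEnv-trans Γ R₁ R₂ , s ,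
       app (⊩-raise R₂ d₁) (subst (u ⊩ C₂ ∶_) (sym (adjust-neg n a)) e₂)
  ... | no ¬n with rederive e C (Ord.inhabited ρ)
  ...   | C₁ , i₁ , R₁ , _ , e₁ with rederive d C₁ (i₁ , j)
  -- As `ρ` is not negative, `RaiseNeg` can only be equality, so the function accepts the offered
  -- `i₁`.
  ...     | C₂ , (_ , j₂) , R₂ , (inj₁ refl , s) , d₂ =
    C₂ , j₂ , raiseEnv-trans Γ R₁ R₂ , s , app d₂ (⊩-raise R₂ e₁)
  ...     | _ , _ , _ , (inj₂ (n , _) , _) , _ = contradiction n ¬n
  rederive (lam d) C (i , j) =
    let ((C' , i') , j' , (R , r) , s , d') = rederive d (C , i) j
    in C' , (i' , j') , R , (r , s) , lam d'

-- Preservation of approximations by `emb` and `proj`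

module Soundness (𝓕 : FilterAssignment) {B : Set} (𝓘 : Interp B) (int : IsInterp 𝓕 𝓘) where
  open FilterAssignment 𝓕
  open Semantics 𝓕 𝓘
  open IsInterp int
  open Polarity {B}
  open Derivations 𝓕 𝓘

  module D (ρ : Ty B) = FSData (Dat ρ)
  module S (ρ : Ty B) = IsFactorSystem (factor ρ)
  module FS (ρ : Ty B) = FactorSystem (factor ρ)
  module Lm (ρ : Ty B) = LimData (Lim ρ)
  module IL (ρ : Ty B) = IsLimit (limit ρ)
  module LP (ρ : Ty B) = Limit 𝓕 {Lm = Lim ρ} (factor ρ) (limit ρ)

  -- By directness, `z` approximating `a` means closeness to `emb i k a`, hence to the two-step
  -- embedding through `j`. Read backwards, directness gives the bound for `LR-intro`.
  base-emb-LR : ∀ b {A i j a} → Ord._≤_ (base b) i j → Lm.LR (base b) A i a →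
                Lm.LR (base b) A j (D.emb (base b) i j a)
  base-emb-LR b {A} {i} {j} {a} i≤j Aa = LP.LR-intro (base b) tt tt λ k z j≤k Az →
    let i≤k  = Ord.≤-trans (base b) i≤j j≤k
        z≈   = FS.≈⇒R (base b) (proj₁ (direct b z a i≤k tt tt)
                 (IL.coh (base b) A tt i k z a i≤k Az Aa))
        comp = FS.≈⇒R (base b) (S.emb-comp (base b) a i≤j j≤k tt)
    in proj₂ (direct b z _ j≤k tt tt)
         (FS.R⇒≈ (base b) (FS.R-trans (base b) z≈ (FS.R-sym (base b) comp)))

  -- Mutual with `proj-LR`: `emb` on functions projects the argument and embeds the value, just as
  -- the polarities of domain and codomain require.
  emb-LR : ∀ {ρ} → Pos ρ → ∀ {A i j a} → Ord._≤_ ρ i j →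
           Lm.LR ρ A i a → Lm.LR ρ A j (D.emb ρ i j a)
  proj-LR : ∀ {ρ} → Neg ρ → ∀ {A i j a} → Ord._≤_ ρ j i →
            Lm.LR ρ A i a → Lm.LR ρ A j (D.proj ρ i j a)

  emb-LR pos-prop _ Aa = Aa
  emb-LR (pos-base b) i≤j Aa = base-emb-LR b i≤j Aa
  emb-LR {ρ ⇒ σ} (pos-fun n p) (i≤ , j≤) (elg , fg) =
    S.emb-El (ρ ⇒ σ) _ (i≤ , j≤) elg ,
    λ a x ina ax → emb-LR p j≤ (fg a _ ina (proj-LR n i≤ ax))

  proj-LR neg-prop _ Aa = Aa
  proj-LR {ρ ⇒ σ} (neg-fun p n) (i≤ , j≤) (elg , fg) =
    S.proj-El (ρ ⇒ σ) _ (i≤ , j≤) elg ,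
    λ a x ina ax → proj-LR n j≤ (fg a _ ina (emb-LR p i≤ ax))

  -- Membership in the limit

  Eq⇒LR : ∀ ρ {A A'} → Lm.Eq ρ A A' → ∀ {i a} → Lm.LR ρ A i a → Lm.LR ρ A' i a
  Eq⇒LR prop refl Aa = Aa
  Eq⇒LR (base b) refl Aa = Aa
  Eq⇒LR (ρ ⇒ σ) eq (elg , fg) = elg , λ a x ina ax → Eq⇒LR σ (eq a ina) (fg a x ina ax)

  -- An approximation `y` of `A'` and the given `x` both lie below a common `z`, taken at an index
  -- beyond that of `y`.
  cofinally-common⇒LR : ∀ ρ {A A'} → Lm.In ρ A → Lm.In ρ A' →
    (∀ i → Σ[ k ∈ Ix ρ ] (Ord._≤_ ρ i k × Σ[ z ∈ Mv ρ k ] (Lm.LR ρ A k z × Lm.LR ρ A' k z))) →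
    ∀ i x → Lm.LR ρ A i x → Lm.LR ρ A' i x
  cofinally-common⇒LR ρ {A} {A'} inA inA' common i x Ax =
    LP.LR-intro ρ inA' (IL.LR-El ρ A i x Ax) λ k y i≤k A'y →
      let (l , k≤l , z , Az , A'z) = common k
      in FS.common⇒R ρ i≤k (IL.coh ρ A' inA' k l z y k≤l A'z A'y)
           (IL.coh ρ A inA i l z x (Ord.≤-trans ρ i≤k k≤l) Az Ax)

  approximable-app : ∀ {ρ σ f a} → LP.Approximable (ρ ⇒ σ) f → Lm.In ρ a →
    F (Idx σ) (λ j → Σ[ i ∈ Ix ρ ] ((Σ[ x ∈ Mv ρ i ] Lm.LR ρ a i x) ×
                                    (Σ[ g ∈ Mv (ρ ⇒ σ) (i , j) ] Lm.LR (ρ ⇒ σ) f (i , j) g)))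
  approximable-app {ρ} {σ} {f} {a} apf ina = F-D (Idx ρ) (Idx σ) _ _ apf (IL.filter ρ a ina)

  -- By Condition (D) the values are again approximable, so induction on the codomain applies. Equal
  -- arguments share approximations, so their values share cofinally many, and extensionality makes
  -- them equal.
  approximable⇒In : ∀ ρ {A} → LP.Approximable ρ A → Lm.In ρ A
  approximable⇒In prop _ = tt
  approximable⇒In (base b) _ = tt
  approximable⇒In (ρ ⇒ σ) {f} apf = inf , eqf , apf
    where
    inf : ∀ a → Lm.In ρ a → Lm.In σ (f a)
    inf a ina = approximable⇒In σ
      (F-superset (Idx σ) _ _ (approximable-app {ρ} {σ} apf ina)
        λ { j (i , (x , ax) , g , _ , fg) → g x , fg a x ina ax })

    common : ∀ {a b} → Lm.In ρ a → Lm.In ρ b → Lm.Eq ρ a b → ∀ j →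
      Σ[ k ∈ Ix σ ] (Ord._≤_ σ j k × Σ[ z ∈ Mv σ k ] (Lm.LR σ (f a) k z × Lm.LR σ (f b) k z))
    common {a} {b} ina inb a≡b j =
      let (k , j≤k , i , (x , ax) , g , _ , fg) =
            F-cofinal (Idx σ) _ (approximable-app {ρ} {σ} apf ina) j
      in k , j≤k , g x , fg a x ina ax , fg b x inb (Eq⇒LR ρ a≡b ax)

    eqf : ∀ a b → Lm.In ρ a → Lm.In ρ b → Lm.Eq ρ a b → Lm.Eq σ (f a) (f b)
    eqf a b ina inb a≡b = IL.extensional σ (f a) (f b) (inf a ina) (inf b inb) λ j y →
      cofinally-common⇒LR σ (inf a ina) (inf b inb) (common ina inb a≡b) j y ,
      cofinally-common⇒LR σ (inf b inb) (inf a ina)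
        (λ k → let (l , k≤l , z , az , bz) = common ina inb a≡b k in l , k≤l , z , bz , az) j y

  pos-In : ∀ {ρ} → Pos ρ → ∀ {A i a} → Lm.LR ρ A i a → Lm.In ρ A
  pos-In {ρ} p {A} {i} {a} Aa = approximable⇒In ρ
    (F-upset (Idx ρ) _ (λ { j k j≤k (x , Ax) → D.emb ρ j k x , emb-LR p j≤k Ax }) (i , a , Aa))

  everywhere⇒In : ∀ ρ {A} → (∀ i → Σ[ a ∈ Mv ρ i ] Lm.LR ρ A i a) → Lm.In ρ A
  everywhere⇒In ρ everywhere = approximable⇒In ρ
    (F-upset (Idx ρ) _ (λ _ j _ _ → everywhere j) (Ord.inhabited ρ , everywhere _))

  neg-LR : ∀ {ρ} → Neg ρ → ∀ {A} → Lm.In ρ A → ∀ i → Σ[ a ∈ Mv ρ i ] Lm.LR ρ A i a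
  neg-LR {ρ} n inA i =
    let (k , i≤k , z , Az) = LP.above ρ inA i
    in D.proj ρ k i z , proj-LR n i≤k Az

  -- State values respect `R`

  SEnvR : (Γ : Ctx B) {C : IEnv Γ} → SEnv Γ C → SEnv Γ C → Set
  SEnvR ε _ _ = ⊤
  SEnvR (Γ ▸ ρ) {_ , i} (as , a) (bs , b) = SEnvR Γ as bs × D.R ρ i i a b

  SEnvR-lookup : ∀ {Γ k ρ C} {a b : SEnv Γ C} (x : Γ ∋ k ∶ ρ) → SEnvR Γ a b →
                 D.R ρ (ilookup x C) (ilookup x C) (slookup x a) (slookup x b)
  SEnvR-lookup here (_ , r) = r
  SEnvR-lookup (there x) (R , _) = SEnvR-lookup x R

  SEnvR-sym : ∀ Γ {C} {a b : SEnv Γ C} → SEnvR Γ a b → SEnvR Γ b a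
  SEnvR-sym ε _ = tt
  SEnvR-sym (Γ ▸ ρ) (R , r) = SEnvR-sym Γ R , FS.R-sym ρ r

  SEnvR-reflˡ : ∀ Γ {C} {a b : SEnv Γ C} → SEnvR Γ a b → SEnvR Γ a a
  SEnvR-reflˡ ε _ = tt
  SEnvR-reflˡ (Γ ▸ ρ) (R , r) = SEnvR-reflˡ Γ R , FS.R-reflˡ ρ r

  -- Two environments are compared because an abstraction must send related arguments to related
  -- values.
  sval-R : ∀ {Γ r ρ} {t : Γ ⊢ r ∶ ρ} {C i} (d : t ⊩ C ∶ i) {a b : SEnv Γ C} →
           SEnvR Γ a b → D.R ρ i i (sval d a) (sval d b)
  sval-R (var+ {ρ = ρ} x _ _ c≤j) R = FS.emb-R ρ c≤j (SEnvR-lookup x R)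
  sval-R (var- {ρ = ρ} x _ _ j≤c) R = FS.proj-R ρ j≤c (SEnvR-lookup x R)
  sval-R (app d e) R =
    let (_ , _ , _ , _ , d-R) = sval-R d R in d-R _ _ (sval-R e R)
  sval-R {Γ} (lam {ρ = ρ} {σ} {C} {i = i} {j} d) R =
    el (SEnvR-reflˡ Γ R) , el (SEnvR-reflˡ Γ (SEnvR-sym Γ R)) , Ord.≤-refl ρ , Ord.≤-refl σ ,
    λ _ _ r → sval-R d (R , r)
    where
    el : ∀ {a} → SEnvR Γ a a → D.El (ρ ⇒ σ) (i , j) (λ x → sval d (a , x))
    el A = (λ x elx → proj₁ (S.R-El σ (sval-R d (A , S.R-refl ρ x elx)))) ,
           (λ x y _ _ x≈y → FS.R⇒≈ σ (sval-R d (A , FS.≈⇒R ρ x≈y)))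

  -- The strengthened relation and the main induction

  Approximates : (ρ : Ty B) → Lv ρ → (i : Ix ρ) → Mv ρ i → Set
  Approximates ρ A i a = D.El ρ i a × (Polarised ρ → Lm.In ρ A × Lm.LR ρ A i a)

  -- Unlike LR, this covers all arguments of a type without polarity,
  -- whether or not they belong to the limit.
  HLR : (ρ : Ty B) → Lv ρ → (i : Ix ρ) → Mv ρ i → Set
  HLR prop A i a = Lm.LR prop A i a
  HLR (base b) A i a = Lm.LR (base b) A i a
  HLR (ρ ⇒ σ) f (i , j) g = ∀ A a → Approximates ρ A i a → HLR σ (f A) j (g a)

  HLR⇒LR : ∀ ρ {A i a} → D.El ρ i a → HLR ρ A i a → Lm.LR ρ A i a
  HLR⇒LR prop _ h = h
  HLR⇒LR (base b) _ h = h
  HLR⇒LR (ρ ⇒ σ) {i = i , _} elg h = elg , λ A a inA Aa →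
    let ela = IL.LR-El ρ A i a Aa
    in HLR⇒LR σ (proj₁ elg a ela) (h A a (ela , λ _ → inA , Aa))

  -- Domains inherit polarity, so the guard in `Approximates` opens and the argument is known to lie
  -- in the limit.
  LR⇒HLR : ∀ ρ → Polarised ρ → ∀ {A i a} → Lm.LR ρ A i a → HLR ρ A i a
  LR⇒HLR prop _ h = h
  LR⇒HLR (base b) _ h = h
  LR⇒HLR (ρ ⇒ σ) pol (_ , fg) A a (_ , approx) =
    let (inA , Aa) = approx (polarised-dom pol)
    in LR⇒HLR σ (polarised-cod pol) (fg A a inA Aa)

  EnvApproximates : (Γ : Ctx B) {C : IEnv Γ} → LEnv Γ → SEnv Γ C → Set
  EnvApproximates ε _ _ = ⊤
  EnvApproximates (Γ ▸ ρ) {_ , i} (As , A) (as , a) =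
    EnvApproximates Γ As as × Approximates ρ A i a

  env-lookup : ∀ {Γ k ρ C A} {a : SEnv Γ C} (x : Γ ∋ k ∶ ρ) → EnvApproximates Γ A a →
               Approximates ρ (llookup x A) (ilookup x C) (slookup x a)
  env-lookup here (_ , h) = h
  env-lookup (there x) (H , _) = env-lookup x H

  env-tabulate : ∀ Γ {C A} {a : SEnv Γ C} →
    (∀ {k τ} (x : Γ ∋ k ∶ τ) → Approximates τ (llookup x A) (ilookup x C) (slookup x a)) →
    EnvApproximates Γ A a
  env-tabulate ε _ = tt
  env-tabulate (Γ ▸ ρ) h = env-tabulate Γ (λ x → h (there x)) , h here

  env-R : ∀ Γ {C A} {a : SEnv Γ C} → EnvApproximates Γ A a → SEnvR Γ a a
  env-R ε _ = tt
  env-R (Γ ▸ ρ) (H , ela , _) = env-R Γ H , S.R-refl ρ _ ela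

  -- The limit environment stays fixed. A raised entry has negative type, so `neg-LR` finds an
  -- approximation at the new index.
  env-raise : ∀ Γ {C C' A} {a : SEnv Γ C} → RaiseEnv Γ C C' → EnvApproximates Γ A a →
              Σ[ a' ∈ SEnv Γ C' ] EnvApproximates Γ A a'
  env-raise ε _ _ = tt , tt
  env-raise (Γ ▸ ρ) {a = _ , a} (R , inj₁ refl) (H , h) =
    let (as' , H') = env-raise Γ R H in (as' , a) , H' , h
  env-raise (Γ ▸ ρ) {C' = _ , i'} {A = _ , A} (R , inj₂ (n , _)) (H , _ , h) =
    let (as' , H') = env-raise Γ R H
        inA        = proj₁ (h (inj₂ n))
        (a' , Aa') = neg-LR n inA i'
    in (as' , a') , H' , IL.LR-El ρ A i' a' Aa' , λ _ → inA , Aa'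

  sval-El : ∀ {Γ r ρ} {t : Γ ⊢ r ∶ ρ} {C i} (d : t ⊩ C ∶ i) {A} {a : SEnv Γ C} →
            EnvApproximates Γ A a → D.El ρ i (sval d a)
  sval-El {Γ} {ρ = ρ} d H = proj₁ (S.R-El ρ (sval-R d (env-R Γ H)))

  -- The recursion is on the typing derivation `t`, since `lval-In` passes to rederived state
  -- derivations that are not parts of `d`.
  sval-HLR : ∀ {Γ r ρ} (t : Γ ⊢ r ∶ ρ) {C i} (d : t ⊩ C ∶ i) {A} {a : SEnv Γ C} →
             EnvApproximates Γ A a → HLR ρ (lval t A) i (sval d a)

  sval-LR : ∀ {Γ r ρ} (t : Γ ⊢ r ∶ ρ) {C i} (d : t ⊩ C ∶ i) {A} {a : SEnv Γ C} →
            EnvApproximates Γ A a → Lm.LR ρ (lval t A) i (sval d a)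
  sval-LR {ρ = ρ} t d H = HLR⇒LR ρ (sval-El d H) (sval-HLR t d H)

  lval-In : ∀ {Γ r ρ} (t : Γ ⊢ r ∶ ρ) {C i} → t ⊩ C ∶ i → ∀ {A} {a : SEnv Γ C} →
            EnvApproximates Γ A a → Polarised ρ → Lm.In ρ (lval t A)
  lval-In t d H (inj₁ p) = pos-In p (sval-LR t d H)
  lval-In {Γ} {ρ = ρ} t {C} d {A} H (inj₂ n) = everywhere⇒In ρ approx
    where
    approx : ∀ i → Σ[ x ∈ Mv ρ i ] Lm.LR ρ (lval t A) i x
    approx i with rederive d C i
    ... | C' , i' , R , s , d' with adjust-neg n s
    ...   | refl = let (_ , H') = env-raise Γ R H in _ , sval-LR t d' H'

  sval-HLR (⊢var _) (var+ {ρ = ρ} x p _ c≤j) H =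
    LR⇒HLR ρ (inj₁ p) (emb-LR p c≤j (proj₂ (proj₂ (env-lookup x H) (inj₁ p))))
  sval-HLR (⊢var _) (var- {ρ = ρ} x n _ j≤c) H =
    LR⇒HLR ρ (inj₂ n) (proj-LR n j≤c (proj₂ (proj₂ (env-lookup x H) (inj₂ n))))
  sval-HLR (⊢app t u) (app d e) H =
    -- Membership of the argument in the limit is owed only when its type has a polarity.
    sval-HLR t d H _ _ (sval-El e H , λ pol → lval-In u e H pol , sval-LR u e H)
  sval-HLR (⊢lam t) (lam d) H = λ _ _ h → sval-HLR t d (H , h)

theorem3p9 : (𝓕 : FilterAssignment) {B : Set} (𝓘 : Interp B) → IsInterp 𝓕 𝓘 →
    let open Semantics 𝓕 𝓘 in
    ∀ {Γ r ρ} (t : Γ ⊢ r ∶ ρ) (C : IEnv Γ) (i : Ix ρ) (d : t ⊩ C ∶ i)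
    (A : LEnv Γ) (a : SEnv Γ C) →
    (∀ {k τ} (x : Γ ∋ k ∶ τ) → LimData.In (Lim τ) (llookup x A)) →
    (∀ {k τ} (x : Γ ∋ k ∶ τ) → FSData.El (Dat τ) (ilookup x C) (slookup x a)) →
    (∀ {k τ} (x : Γ ∋ k ∶ τ) → LimData.LR (Lim τ) (llookup x A) (ilookup x C) (slookup x a)) →
    LimData.LR (Lim ρ) (lval t A) i (sval d a)
theorem3p9 𝓕 𝓘 int {Γ} t C i d A a inA ela Aa =
  sval-LR t d (env-tabulate Γ λ x → ela x , λ _ → inA x , Aa x)
  where open Soundness 𝓕 𝓘 int
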